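{- Let $t \geq 4$ and $m \geq 1$ be integers. Then there exists an infinite set of primes, having positive density within the set of all primes, such that for every prime $p$ in this set the projective norm graph $\mathcal{P}(p,t)$ contains a copy of the complete bipartite graph $K_{t-1,m}$ (as a subgraph).
   Context: For $t \geq 3$ and a prime power $q$, the projective norm graph $\mathcal{P}(q,t)$ is the graph with vertex set $\mathbb{F}_{q^{t-1}} \times \mathbb{F}_q^*$, in which two distinct vertices $(\alpha,a)$ and $(\beta,b)$ are adjacent if and only if $N(\alpha+\beta) = ab$, where $N$ denotes the norm map of the field extension $\mathbb{F}_{q^{t-1}}/\mathbb{F}_q$. A set of primes has density $\delta$ if the proportion of primes up to $x$ that lie in it tends to $\delta$ as $x \to \infty$. -}

module Defs where

open import Level using (0ℓ)
open import Data.Nat using (ℕ; zero; suc; _≤_; _<_; _∸_)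
open import Data.Nat.Primality using (Prime; prime?)
open import Data.Bool using (Bool; true; false; _∧_)
open import Data.List using (List; length; filterᵇ; upTo; map)
open import Data.Nat.ListAction using (sum)
open import Data.Integer using (+_)
open import Data.Rational.Unnormalised as Q using (ℚᵘ; mkℚᵘ; 0ℚᵘ; ∣_∣; _-_)
open import Data.Fin using (Fin)
open import Data.Product using (Σ; ∃; _×_; _,_; proj₁; proj₂)
open import Relation.Nullary using (¬_; does)
open import Relation.Binary.PropositionalEquality using (_≡_)
open import Algebra.Bundles using (CommutativeRing)
import Data.Nat as N

record FiniteField (n : ℕ) : Set₁ where
  field
    cring : CommutativeRing 0ℓ 0ℓ
  open CommutativeRing cring public
  field
    1≉0       : ¬ (1# ≈ 0#)
    inverse   : ∀ x → ¬ (x ≈ 0#) → ∃ λ y → (x * y) ≈ 1#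
    enum      : Fin n → Carrier
    enum-inj  : ∀ i j → enum i ≈ enum j → i ≡ j
    enum-surj : ∀ x → ∃ λ i → enum i ≈ x

module _ {n : ℕ} (K : FiniteField n) where
  open FiniteField K

  pow : Carrier → ℕ → Carrier
  pow x zero    = 1#
  pow x (suc k) = x * pow x k

-- exponent of the norm map of F_{q^k} / F_q :  1 + q + ... + q^(k-1)
-- (so that N(α) = α^((q^k - 1)/(q - 1)))
normExp : ℕ → ℕ → ℕ
normExp q k = sum (map (q N.^_) (upTo k))

-- The projective norm graph P(q,t), realised on a field K of order
-- q^(t-1) (q prime here, so F_q is the prime subfield
-- { a | a^q = a } of K).

module ProjNormGraph (q t : ℕ) (K : FiniteField (q N.^ (t ∸ 1))) where
  open FiniteField K

  norm : Carrier → Carrier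
  norm α = pow K α (normExp q (t ∸ 1))

  InFqStar : Carrier → Set
  InFqStar a = ¬ (a ≈ 0#) × (pow K a q ≈ a)

  Vertex : Set
  Vertex = Σ Carrier λ α → Σ Carrier λ a → InFqStar a

  _≈V_ : Vertex → Vertex → Set
  (α , a , _) ≈V (β , b , _) = (α ≈ β) × (a ≈ b)

  Adj : Vertex → Vertex → Set
  Adj u@(α , a , _) v@(β , b , _) = ¬ (u ≈V v) × (norm (α + β) ≈ (a * b))

  ContainsKrs : ℕ → ℕ → Set
  ContainsKrs r s =
    Σ (Fin r → Vertex) λ A → Σ (Fin s → Vertex) λ B →
      (∀ i j → A i ≈V A j → i ≡ j) ×
      (∀ i j → B i ≈V B j → i ≡ j) ×
      (∀ i j → ¬ (A i ≈V B j)) ×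
      (∀ i j → Adj (A i) (B j))

isPrimeᵇ : ℕ → Bool
isPrimeᵇ n = does (prime? n)

countPrimesIn : (ℕ → Bool) → ℕ → ℕ
countPrimesIn S x = length (filterᵇ (λ n → S n ∧ isPrimeᵇ n) (upTo (suc x)))

primeCount : ℕ → ℕ
primeCount = countPrimesIn (λ _ → true)

-- a / b as a rational (b = 0 is sent to 0; irrelevant for x ≥ 2)
ratio : ℕ → ℕ → ℚᵘ
ratio a zero    = 0ℚᵘ
ratio a (suc b) = mkℚᵘ (+ a) b

proportion : (ℕ → Bool) → ℕ → ℚᵘ
proportion S x = ratio (countPrimesIn S x) (primeCount x)

-- S has a density which is positive: the proportion sequence converges
-- (expressed, without reals, as being Cauchy in ℚ) and its limit is
-- positive (the sequence is eventually bounded below by a positive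
-- rational).
HasPositiveDensity : (ℕ → Bool) → Set
HasPositiveDensity S =
  (∀ (ε : ℚᵘ) → Q.Positive ε →
     ∃ λ M → ∀ x y → M ≤ x → M ≤ y →
       ∣ proportion S x - proportion S y ∣ Q.< ε)
  × (∃ λ (ε : ℚᵘ) → Q.Positive ε × ∃ λ M → ∀ x → M ≤ x → ε Q.≤ proportion S x)

{-# OPTIONS --safe #-}
-- Fix distinct α₀, …, α_{t-2} in K, and send β to the ratios N(αᵢ + β) / N(α₀ + β) with 1 ≤ i ≤ t-2.
-- The ratios lie in F_p*, so apart from the few β with β = αᵢ or β = -αᵢ there are at most
-- p^(t-2) classes among the p^(t-1) elements β; for p large some class contains m of them.
-- If aᵢ is the common ratio on that class and b_β = N(α₀ + β), then N(αᵢ + β) = aᵢ b_β, so the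
-- vertices (αᵢ , aᵢ) and (β , b_β) span K_{t-1,m}. Hence all primes beyond a bound qualify, and
-- these have density 1.
module Submission where

open import Defs

-- Fixing the t-1 norms N(αᵢ + β) themselves would give about p^(t-1) patterns, as many as there are
-- β, so no pattern need repeat. Passing to ratios saves one factor p, and the graph pays nothing
-- for it: the common factor N(α₀ + β) is absorbed by the second coordinate of the vertex over β.
-- Counting values in F_p inside K rests on two facts: x^(p^(t-1)) = x puts the norms among the
-- solutions of a^p = a, and X^p - X has at most p roots. The excluded β fill at most 2(t-1) further
-- classes, so the pigeonhole principle asks for m (p^(t-2) + 2(t-1)) < p^(t-1), which p > m (1 +
-- 2(t-1)) ensures. Omitting the primes up to a bound does not affect the density because the prime
-- count is unbounded, by Euclid's argument.

-- Primes beyond a bound and their density.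

module PrimesAbove where
  open import Data.Nat using (ℕ; zero; suc; _+_; _*_; _!; _≤_; _<_; ≢-nonZero⁻¹;
    _≤′_; ≤′-refl; ≤′-step; z≤n; s≤s; s≤s⁻¹; _≤?_; _<ᵇ_)
  open import Data.Nat.Properties
  open import Data.Nat.Divisibility using (_∣_; ∣m+n∣m⇒∣n; ∣1⇒≡1; m≤n⇒m!∣n!; ∣-trans; m∣m*n)
  open import Data.Nat.Primality using (Prime; prime?; ¬prime[1]; prime⇒nonZero)
  open import Data.Nat.Primality.Factorisation using (factorise)
  open import Data.Nat.Tactic.RingSolver using (solve-∀)
  open import Data.Bool using (Bool; true; false; T; _∧_)
  open import Data.Bool.Properties using (∧-idem)
  open import Data.List using ([]; _∷_; length; filterᵇ; upTo; _∷ʳ_; _++_; [_])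
  open import Data.List.Properties using (upTo-∷ʳ; filter-++; length-++; length-filter; length-upTo)
  open import Data.List.Relation.Unary.All using ([]; _∷_)
  import Data.Integer as ℤ
  open ℤ using (+_)
  import Data.Integer.Properties as ℤ
  open import Data.Rational.Unnormalised as Q using (mkℚᵘ; 1ℚᵘ; ½; *<*; *≤*)
  import Data.Rational.Unnormalised.Properties as Q
  open import Data.Product using (∃; _×_; _,_; proj₁; proj₂)
  open import Data.Sum using (inj₁; inj₂)
  open import Function using (_∘_)
  open import Relation.Nullary using (yes; no; contradiction)
  open import Relation.Nullary.Decidable using (T?; dec-true)
  open import Relation.Binary.PropositionalEquality hiding ([_])

  prime∣! : ∀ {p n} → Prime p → p ≤ n → p ∣ n !
  prime∣! {suc p} _ p≤n = ∣-trans (m∣m*n (p !)) (m≤n⇒m!∣n! p≤n)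
  prime∣! {zero} pr _ = contradiction (prime⇒nonZero pr) λ ()

  -- Euclid: a prime factor of `n ! + 1` that is at most `n` would divide `n !` and hence 1.
  ∃prime> : ∀ n → ∃ λ p → n < p × Prime p
  ∃prime> n with factorise (suc (n !))
  ... | record { factors = [] ; isFactorisation = eq } =
    contradiction (suc-injective eq) (≢-nonZero⁻¹ (n !) ⦃ n !≢0 ⦄)
  ... | record { factors = p ∷ ps ; isFactorisation = eq ; factorsPrime = pr ∷ _ } = p , n<p , pr
    where
    p∣1+n! : p ∣ n ! + 1
    p∣1+n! = subst (p ∣_) (trans (sym eq) (+-comm 1 (n !))) (m∣m*n _)

    n<p : n < p
    n<p = ≰⇒> λ p≤n → ¬prime[1] (subst Prime (∣1⇒≡1 (∣m+n∣m⇒∣n p∣1+n! (prime∣! pr p≤n))) pr)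

  countUpTo : (ℕ → Bool) → ℕ → ℕ
  countUpTo f x = length (filterᵇ f (upTo (suc x)))

  indicator : Bool → ℕ
  indicator true  = 1
  indicator false = 0

  countUpTo-suc : ∀ f x → countUpTo f (suc x) ≡ countUpTo f x + indicator (f (suc x))
  countUpTo-suc f x = begin
    length (filterᵇ f (upTo (2 + x)))              ≡⟨ cong (length ∘ filterᵇ f) (upTo-∷ʳ (suc x)) ⟨
    length (filterᵇ f (upTo (suc x) ∷ʳ suc x))     ≡⟨ cong length (filter-++ (T? ∘ f) (upTo (suc x)) [ suc x ]) ⟩
    length (filterᵇ f (upTo (suc x)) ++ filterᵇ f [ suc x ]) ≡⟨ length-++ (filterᵇ f (upTo (suc x))) ⟩
    countUpTo f x + length (filterᵇ f [ suc x ])   ≡⟨ cong (_+_ (countUpTo f x)) singleton ⟩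
    countUpTo f x + indicator (f (suc x))          ∎
    where
    open ≡-Reasoning
    singleton : length (filterᵇ f [ suc x ]) ≡ indicator (f (suc x))
    singleton with f (suc x)
    ... | true  = refl
    ... | false = refl

  countUpTo-mono : ∀ f {x y} → x ≤ y → countUpTo f x ≤ countUpTo f y
  countUpTo-mono f x≤y = go (≤⇒≤′ x≤y)
    where
    go : ∀ {x y} → x ≤′ y → countUpTo f x ≤ countUpTo f y
    go ≤′-refl = ≤-refl
    go {x} (≤′-step {y} x≤y) = ≤-trans (go x≤y) (≤-trans (m≤m+n _ _) (≤-reflexive (sym (countUpTo-suc f y))))

  countUpTo≤ : ∀ f x → countUpTo f x ≤ suc x
  countUpTo≤ f x = ≤-trans (length-filter (T? ∘ f) (upTo (suc x))) (≤-reflexive (length-upTo (suc x)))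

  -- A prime beyond the threshold for `k` raises the count once more, so it is a threshold for
  -- `suc k`.
  primeCount-unbounded : ∀ k → ∃ λ M → ∀ x → M ≤ x → k ≤ primeCount x
  primeCount-unbounded zero    = 0 , λ _ _ → z≤n
  primeCount-unbounded (suc k) with primeCount-unbounded k
  ... | M , bound with ∃prime> M
  ... | suc p , M<p , pr = suc p , λ x p≤x → ≤-trans k<π[p] (countUpTo-mono isPrimeᵇ p≤x)
    where
    k<π[p] : suc k ≤ primeCount (suc p)
    k<π[p] rewrite countUpTo-suc isPrimeᵇ p | dec-true (prime? (suc p)) pr | +-comm (primeCount p) 1 =
      s≤s (bound p (s≤s⁻¹ M<p))

  -- Primality is built in because the theorem asks that every member be prime. `countPrimesIn`
  -- tests it again, and `∧-idem` merges the two tests.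
  primesAbove : ℕ → ℕ → Bool
  primesAbove B n = (B <ᵇ n) ∧ isPrimeᵇ n

  primesAbove-sound : ∀ B {p} → primesAbove B p ≡ true → B < p × Prime p
  primesAbove-sound B {p} eq with B <ᵇ p in B<p | prime? p
  ... | true | yes pr = <ᵇ⇒< B p (subst T (sym B<p) _) , pr

  primesAbove-complete : ∀ B {p} → B < p → Prime p → primesAbove B p ≡ true
  primesAbove-complete B {p} B<p pr with B <ᵇ p | <⇒<ᵇ B<p
  ... | true | _ = dec-true (prime? p) pr

  module _ (B : ℕ) where
    private
      π s : ℕ → ℕ
      π = primeCount
      s = countPrimesIn (primesAbove B)

      S∧prime : ℕ → Bool
      S∧prime n = primesAbove B n ∧ isPrimeᵇ n

    indicator≤ : ∀ n → indicator (S∧prime n) ≤ indicator (isPrimeᵇ n)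
    indicator≤ n with B <ᵇ n | isPrimeᵇ n
    ... | false | _     = z≤n
    ... | true  | false = ≤-refl
    ... | true  | true  = ≤-refl

    indicator-above : ∀ n → B < n → indicator (isPrimeᵇ n) ≡ indicator (S∧prime n)
    indicator-above n B<n with B <ᵇ n | <⇒<ᵇ B<n
    ... | true | _ = cong indicator (sym (∧-idem (isPrimeᵇ n)))

    countAbove≤primeCount : ∀ x → s x ≤ π x
    countAbove≤primeCount zero    = z≤n′
      where
      z≤n′ : s 0 ≤ π 0
      z≤n′ with B <ᵇ 0
      ... | false = z≤n
      ... | true  = z≤n
    countAbove≤primeCount (suc x)
      rewrite countUpTo-suc isPrimeᵇ x | countUpTo-suc S∧prime x
      = +-mono-≤ (countAbove≤primeCount x) (indicator≤ (suc x))

    -- Only the `suc B` numbers from 0 to `B` can be lost.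
    primeCount≤countAbove : ∀ x → π x ≤ s x + suc B
    primeCount≤countAbove x with x ≤? B
    ... | yes x≤B = ≤-trans (countUpTo≤ isPrimeᵇ x) (≤-trans (s≤s x≤B) (m≤n+m _ (s x)))
    primeCount≤countAbove zero    | no 0≰B = contradiction z≤n 0≰B
    primeCount≤countAbove (suc x) | no x≰B
      rewrite countUpTo-suc isPrimeᵇ x | countUpTo-suc S∧prime x | indicator-above (suc x) (≰⇒> x≰B) = begin
        π x + i           ≤⟨ +-monoˡ-≤ i (primeCount≤countAbove x) ⟩
        s x + suc B + i   ≡⟨ +-assoc (s x) (suc B) i ⟩
        s x + (suc B + i) ≡⟨ cong (_+_ (s x)) (+-comm (suc B) i) ⟩
        s x + (i + suc B) ≡⟨ +-assoc (s x) i (suc B) ⟨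
        s x + i + suc B   ∎
      where
      open ≤-Reasoning
      i = indicator (S∧prime (suc x))

  ratio≤1 : ∀ {a b} → a ≤ b → ratio a b Q.≤ 1ℚᵘ
  ratio≤1 {b = zero}  _   = *≤* (ℤ.+≤+ z≤n)
  ratio≤1 {a} {suc b} a≤b =
    *≤* (subst₂ ℤ._≤_ (sym (ℤ.*-identityʳ (+ a))) (sym (ℤ.*-identityˡ (+ suc b))) (ℤ.+≤+ a≤b))

  -- Of `b` primes at most `c` are missed, and the share `c / b` is below 1/(d+1), hence below the
  -- added (e+1)/(d+1).
  1<ratio+ε : ∀ {a b c e d} → b ≤ a + c → c * suc d < b → 1ℚᵘ Q.< ratio a b Q.+ mkℚᵘ (+ suc e) d
  1<ratio+ε {a} {suc b} {c} {e} {d} b≤a+c cd<b = *<* (subst₂ ℤ._<_ lhs rhs (ℤ.+<+ main))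
    where
    lhs : + (suc b * suc d) ≡ ℤ.1ℤ ℤ.* + (suc b * suc d)
    lhs = sym (ℤ.*-identityˡ _)
    rhs : + (a * suc d + suc e * suc b) ≡ (+ a ℤ.* + suc d ℤ.+ + suc e ℤ.* + suc b) ℤ.* ℤ.1ℤ
    rhs = trans (trans (ℤ.pos-+ (a * suc d) _) (cong₂ ℤ._+_ (ℤ.pos-* a (suc d)) (ℤ.pos-* (suc e) (suc b))))
                (sym (ℤ.*-identityʳ _))
    open ≤-Reasoning
    main : suc b * suc d < a * suc d + suc e * suc b
    main = begin-strict
      suc b * suc d             ≤⟨ *-monoˡ-≤ (suc d) b≤a+c ⟩
      (a + c) * suc d           ≡⟨ *-distribʳ-+ (suc d) a c ⟩
      a * suc d + c * suc d     <⟨ +-monoʳ-< (a * suc d) cd<b ⟩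
      a * suc d + suc b         ≤⟨ +-monoʳ-≤ (a * suc d) (m≤m+n (suc b) (e * suc b)) ⟩
      a * suc d + suc e * suc b ∎

  -- Doubling the first hypothesis gives 2b ≤ 2a + 2c ≤ 2a + b, from which `b` cancels.
  ½≤ratio : ∀ {a b c} → b ≤ a + c → c * 2 < b → ½ Q.≤ ratio a b
  ½≤ratio {a} {suc b} {c} b≤a+c 2c<b =
    *≤* (subst₂ ℤ._≤_ (sym (ℤ.*-identityˡ (+ suc b))) (ℤ.pos-* a 2) (ℤ.+≤+ main))
    where
    open ≤-Reasoning
    main : suc b ≤ a * 2
    main = +-cancelʳ-≤ (suc b) (suc b) (a * 2) (begin
      suc b + suc b     ≡⟨ n+n≡n*2 (suc b) ⟩
      suc b * 2         ≤⟨ *-monoˡ-≤ 2 b≤a+c ⟩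
      (a + c) * 2       ≡⟨ *-distribʳ-+ 2 a c ⟩
      a * 2 + c * 2     ≤⟨ +-monoʳ-≤ (a * 2) (<⇒≤ 2c<b) ⟩
      a * 2 + suc b     ∎)
      where
      n+n≡n*2 : ∀ n → n + n ≡ n * 2
      n+n≡n*2 = solve-∀

  p<q+r⇒p-q<r : ∀ p q r → p Q.< q Q.+ r → p Q.- q Q.< r
  p<q+r⇒p-q<r p q r p<q+r = begin-strict
    p Q.- q         <⟨ Q.+-monoˡ-< (Q.- q) p<q+r ⟩
    q Q.+ r Q.- q   ≃⟨ Q.+-congˡ (Q.- q) (Q.+-comm q r) ⟩
    r Q.+ q Q.- q   ≃⟨ Q.+-assoc r q (Q.- q) ⟩
    r Q.+ (q Q.- q) ≃⟨ Q.+-congʳ r (Q.+-inverseʳ q) ⟩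
    r Q.+ Q.0ℚᵘ     ≃⟨ Q.+-identityʳ r ⟩
    r               ∎
    where open Q.≤-Reasoning

  ∣p-q∣<ε : ∀ p q ε → p Q.< q Q.+ ε → q Q.< p Q.+ ε → Q.∣ p Q.- q ∣ Q.< ε
  ∣p-q∣<ε p q ε p<q+ε q<p+ε with Q.∣p∣≡p∨∣p∣≡-p (p Q.- q)
  ... | inj₁ eq = subst (Q._< ε) (sym eq) (p<q+r⇒p-q<r p q ε p<q+ε)
  ... | inj₂ eq = subst (Q._< ε) (sym eq) (Q.<-respˡ-≃ flip (p<q+r⇒p-q<r q p ε q<p+ε))
    where
    flip : q Q.- p Q.≃ Q.- (p Q.- q)
    flip = begin-equality
      q Q.- p                 ≃⟨ Q.+-comm q (Q.- p) ⟩
      Q.- p Q.+ q             ≃⟨ Q.+-congʳ (Q.- p) (Q.neg-involutive q) ⟨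
      Q.- p Q.+ Q.- (Q.- q)   ≃⟨ Q.≃-reflexive (Q.neg-distrib-+ p (Q.- q)) ⟨
      Q.- (p Q.- q)           ∎
      where open Q.≤-Reasoning

  -- All late proportions lie between 1 - ε and 1, so any two of them differ by less than `ε`.
  primesAbove-density : ∀ B → HasPositiveDensity (primesAbove B)
  primesAbove-density B = cauchy , ½ , _ , eventually≥½
    where
    P = proportion (primesAbove B)
    P≤1 : ∀ x → P x Q.≤ 1ℚᵘ
    P≤1 x = ratio≤1 (countAbove≤primeCount B x)

    -- At most `suc B` primes are missed, so past this point their share is below 1/(d+1), where d+1
    -- is the denominator of `ε`; `d` is 1 for the lower bound `½`.
    threshold : ∀ d → ∃ λ M → ∀ x → M ≤ x → suc B * suc d < primeCount x
    threshold d = primeCount-unbounded (suc (suc B * suc d))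

    cauchy : ∀ ε → Q.Positive ε → ∃ λ M → ∀ x y → M ≤ x → M ≤ y → Q.∣ P x Q.- P y ∣ Q.< ε
    cauchy (mkℚᵘ (+ suc e) d) _ = proj₁ (threshold d) , λ x y M≤x M≤y →
      ∣p-q∣<ε (P x) (P y) ε (Q.≤-<-trans (P≤1 x) (1<P+ε y M≤y)) (Q.≤-<-trans (P≤1 y) (1<P+ε x M≤x))
      where
      ε = mkℚᵘ (+ suc e) d
      1<P+ε : ∀ x → proj₁ (threshold d) ≤ x → 1ℚᵘ Q.< P x Q.+ ε
      1<P+ε x M≤x = 1<ratio+ε (primeCount≤countAbove B x) (proj₂ (threshold d) x M≤x)

    eventually≥½ : ∃ λ M → ∀ x → M ≤ x → ½ Q.≤ P x
    eventually≥½ = proj₁ (threshold 1) , λ x M≤x →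
      ½≤ratio (primeCount≤countAbove B x) (proj₂ (threshold 1) x M≤x)

-- A pigeonhole principle with large fibres.

module Pigeonhole where
  open import Data.Nat using (ℕ; zero; suc; _+_; _*_; _≤_; _<_; z≤n; s≤s; s≤s⁻¹; _<?_; _≟_)
  open import Data.Nat.Properties
  open import Data.Fin using (Fin; zero; suc; toℕ; inject≤)
  open import Data.Fin.Properties using (toℕ<n; toℕ-injective; inject≤-injective)
  open import Data.List using (List; []; _∷_; length; filter; lookup; allFin)
  open import Data.List.Properties using (length-tabulate)
  open import Data.List.Membership.Propositional.Properties using (∈-lookup)
  import Data.List.Relation.Binary.Sublist.Propositional.Properties as Sublist
  open import Data.List.Relation.Unary.All as All using (All; []; _∷_)
  import Data.List.Relation.Unary.All.Properties as All
  open import Data.List.Relation.Unary.AllPairs using (_∷_)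
  open import Data.List.Relation.Unary.Unique.Propositional using (Unique)
  import Data.List.Relation.Unary.Unique.Propositional.Properties as Unique
  open import Data.Product using (∃; _×_; _,_; proj₁; proj₂)
  open import Function using (_∘_; id)
  open import Level using (0ℓ)
  open import Relation.Nullary using (yes; no; contradiction; ¬?)
  open import Relation.Unary using (Pred; Decidable)
  open import Relation.Binary.PropositionalEquality

  module _ {A : Set} where

    lookup-injective : ∀ {xs : List A} → Unique xs → ∀ i j → lookup xs i ≡ lookup xs j → i ≡ j
    lookup-injective (_  ∷ _)   zero    zero    _  = refl
    lookup-injective (x∉ ∷ _)   zero    (suc j) eq = contradiction eq (All.lookup x∉ (∈-lookup j))
    lookup-injective (x∉ ∷ _)   (suc i) zero    eq = contradiction (sym eq) (All.lookup x∉ (∈-lookup i))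
    lookup-injective (_  ∷ xs!) (suc i) (suc j) eq = cong suc (lookup-injective xs! i j eq)

    length-filter-split : ∀ {P : Pred A 0ℓ} (P? : Decidable P) xs →
      length xs ≡ length (filter P? xs) + length (filter (¬? ∘ P?) xs)
    length-filter-split P? [] = refl
    length-filter-split P? (x ∷ xs) with P? x
    ... | yes _ = cong suc (length-filter-split P? xs)
    ... | no  _ = trans (cong suc (length-filter-split P? xs)) (sym (+-suc _ _))

    -- Induction on the number of colours: if the top colour has at most `m` elements, discarding
    -- them leaves more than `m * C` elements in `C` colours. Colours are natural numbers so that
    -- lowering the bound keeps `f` unchanged.
    large-fibre : ∀ m C (f : A → ℕ) {xs} → All (λ x → f x < C) xs → m * C < length xs →
      ∃ λ c → m < length (filter (λ x → f x ≟ c) xs)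
    large-fibre m zero f {x ∷ xs} (() ∷ _)
    large-fibre m zero f {[]} [] ()
    large-fibre m (suc C) f {xs} f<1+C mC<∣xs∣ with m <? length (filter (λ x → f x ≟ C) xs)
    ... | yes m<fibre = C , m<fibre
    ... | no  m≮fibre with large-fibre m C f f<C mC<rest
      where
      open ≤-Reasoning
      rest = filter (¬? ∘ (λ x → f x ≟ C)) xs
      f<C : All (λ x → f x < C) rest
      f<C = All.zipWith (λ (f<1+C , f≢C) → ≤∧≢⇒< (s≤s⁻¹ f<1+C) f≢C)
              (All.filter⁺ (¬? ∘ (λ x → f x ≟ C)) f<1+C , All.all-filter (¬? ∘ (λ x → f x ≟ C)) xs)
      mC<rest : m * C < length rest
      mC<rest = +-cancelˡ-< m _ _ (begin-strict
        m + m * C ≡⟨ *-suc m C ⟨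
        m * suc C <⟨ mC<∣xs∣ ⟩
        length xs ≡⟨ length-filter-split (λ x → f x ≟ C) xs ⟩
        length (filter (λ x → f x ≟ C) xs) + length rest ≤⟨ +-monoˡ-≤ (length rest) (≮⇒≥ m≮fibre) ⟩
        m + length rest ∎)
    -- A fibre within `rest` is a sublist of the fibre of the same colour within `xs`.
    ... | c , m<fibre = c , ≤-trans m<fibre (Sublist.length-mono-≤
            (Sublist.filter⁺ (λ x → f x ≟ c) (λ x → f x ≟ c) (λ { refl → id }) (Sublist.filter-⊆ _ xs)))

  pigeonhole-fibre : ∀ {N C} m (f : Fin N → Fin C) → m * C < N →
    ∃ λ (g : Fin (suc m) → Fin N) → (∀ i j → g i ≡ g j → i ≡ j) × (∀ i j → f (g i) ≡ f (g j))
  pigeonhole-fibre {N} {C} m f mC<N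
    with c , m<fibre ← large-fibre m C (toℕ ∘ f) {allFin N} (All.universal (toℕ<n ∘ f) _)
                         (≤-trans mC<N (≤-reflexive (sym (length-tabulate id))))
    = g , g-injective , λ i j → toℕ-injective (trans (f∘g≡c i) (sym (f∘g≡c j)))
    where
    f≟c = λ i → toℕ (f i) ≟ c
    fibre = filter f≟c (allFin N)

    g : Fin (suc m) → Fin N
    g i = lookup fibre (inject≤ i m<fibre)

    g-injective : ∀ i j → g i ≡ g j → i ≡ j
    g-injective i j = inject≤-injective m<fibre m<fibre i j ∘
      lookup-injective (Unique.filter⁺ f≟c (Unique.allFin⁺ N)) _ _

    f∘g≡c : ∀ i → toℕ (f (g i)) ≡ c
    f∘g≡c i = All.lookup (All.all-filter f≟c (allFin N)) (∈-lookup (inject≤ i m<fibre))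

module NormGraph where
  open Pigeonhole
  open import Level using (0ℓ)
  open import Data.Nat using (ℕ; zero; suc; _≤_; _<_; z≤n; s≤s)
  import Data.Nat as ℕ
  import Data.Nat.Properties as ℕ
  open import Data.Fin as Fin using (Fin; zero; suc; inject≤; funToFin; finToFun; join; splitAt)
  import Data.Fin.Properties as Fin
  open import Data.Fin.Permutation using (Permutation′; permutation; _⟨$⟩ʳ_)
  open import Data.List using (List; []; _∷_; length; replicate; filter; allFin; map; upTo; _∷ʳ_; _++_; [_])
  open import Data.List.Properties using (length-replicate; length-map; upTo-∷ʳ; map-++)
  import Data.Nat.ListAction as ℕ
  open import Data.Nat.ListAction.Properties using (sum-++)
  open import Data.List.Membership.Propositional using (_∈_)
  open import Data.List.Membership.Propositional.Properties using (∈-filter⁺; ∈-allFin)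
  open import Data.List.Membership.Setoid.Properties using (index-injective)
  open import Data.List.Relation.Unary.Any using (index)
  open import Data.List.Relation.Unary.All as All using (All; []; _∷_)
  import Data.List.Relation.Unary.All.Properties as All
  open import Data.List.Relation.Unary.AllPairs as AllPairs using (AllPairs; []; _∷_)
  import Data.List.Relation.Unary.AllPairs.Properties as AllPairs
  import Data.List.Relation.Unary.Unique.Propositional.Properties as Unique
  open import Data.Product using (∃; _×_; _,_; proj₁; proj₂)
  open import Data.Sum using (_⊎_; inj₁; inj₂; map₂)
  open import Data.Sum.Properties using (inj₁-injective; inj₂-injective)
  open import Function using (_∘_)
  open import Relation.Nullary using (¬_; Dec; yes; no; contradiction)
  open import Relation.Nullary.Decidable using (map′; _⊎-dec_)
  open import Relation.Binary.PropositionalEquality as ≡ using (_≡_; _≢_)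
  open import Algebra.Bundles using (CommutativeMonoid)
  import Algebra.Properties.CommutativeMonoid.Sum
  import Algebra.Properties.Ring
  import Algebra.Properties.Semiring.Exp
  import Algebra.Properties.CommutativeSemiring.Exp
  import Algebra.Properties.CommutativeSemigroup
  import Relation.Binary.Reasoning.Setoid

  module _ (M : CommutativeMonoid 0ℓ 0ℓ) where
    open CommutativeMonoid M
    open Algebra.Properties.CommutativeMonoid.Sum M
    open import Relation.Binary.Reasoning.Setoid setoid

    -- Applied to the multiplicative monoid, where `sum` is a product and `ε` is one.
    sum-supported-at : ∀ {n} (f : Fin n → Carrier) i → (∀ j → j ≢ i → f j ≈ ε) → sum f ≈ f i
    sum-supported-at {suc n} f i f≈ε = begin
      sum f                              ≈⟨ sum-remove f ⟩
      f i ∙ sum (removeAt f i)           ≈⟨ ∙-congˡ (sum-cong-≋ (λ j → f≈ε _ (Fin.punchInᵢ≢i i j))) ⟩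
      f i ∙ sum {n} (λ _ → ε)            ≈⟨ ∙-congˡ (sum-replicate-zero n) ⟩
      f i ∙ ε                            ≈⟨ identityʳ (f i) ⟩
      f i                                ∎
      where open import Data.Vec.Functional using (removeAt)

  -- Finite fields: powers, roots of polynomials, elements fixed by the q-th power.

  module _ {n : ℕ} (K : FiniteField n) where
    open FiniteField K hiding (zero)
    open Algebra.Properties.Ring ring
    open Algebra.Properties.Semiring.Exp semiring
    open Algebra.Properties.CommutativeSemigroup *-commutativeSemigroup
    open Relation.Binary.Reasoning.Setoid setoid
    private module Π = Algebra.Properties.CommutativeMonoid.Sum *-commutativeMonoid

    pow≡^ : ∀ x k → pow K x k ≡ x ^ k
    pow≡^ x zero    = ≡.refl
    pow≡^ x (suc k) = ≡.cong (x *_) (pow≡^ x k)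

    code : Carrier → Fin n
    code x = proj₁ (enum-surj x)

    enum-code : ∀ x → enum (code x) ≈ x
    enum-code x = proj₂ (enum-surj x)

    code-enum : ∀ i → code (enum i) ≡ i
    code-enum i = enum-inj _ _ (enum-code (enum i))

    code-cong : ∀ {x y} → x ≈ y → code x ≡ code y
    code-cong x≈y = enum-inj _ _ (trans (enum-code _) (trans x≈y (sym (enum-code _))))

    code-injective : ∀ {x y} → code x ≡ code y → x ≈ y
    code-injective eq = trans (sym (enum-code _)) (trans (reflexive (≡.cong enum eq)) (enum-code _))

    infix 4 _≈?_
    -- The enumeration transports decidable equality from `Fin n` to the setoid of `K`.
    _≈?_ : ∀ x y → Dec (x ≈ y)
    x ≈? y = map′ code-injective code-cong (code x Fin.≟ code y)

    *-cancelˡ-≉0 : ∀ {x y z} → ¬ (x ≈ 0#) → x * y ≈ x * z → y ≈ z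
    *-cancelˡ-≉0 {x} {y} {z} x≉0 xy≈xz with w , xw≈1 ← inverse x x≉0 = begin
      y           ≈⟨ lemma y ⟨
      w * (x * y) ≈⟨ *-congˡ xy≈xz ⟩
      w * (x * z) ≈⟨ lemma z ⟩
      z           ∎
      where
      lemma : ∀ u → w * (x * u) ≈ u
      lemma u = begin
        w * (x * u) ≈⟨ x∙yz≈yx∙z w x u ⟩
        (x * w) * u ≈⟨ *-congʳ xw≈1 ⟩
        1# * u      ≈⟨ *-identityˡ u ⟩
        u           ∎

    *-≉0 : ∀ {x y} → ¬ (x ≈ 0#) → ¬ (y ≈ 0#) → ¬ (x * y ≈ 0#)
    *-≉0 {x} x≉0 y≉0 xy≈0 = y≉0 (*-cancelˡ-≉0 x≉0 (trans xy≈0 (sym (zeroʳ x))))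

    ^-≉0 : ∀ {x} k → ¬ (x ≈ 0#) → ¬ (x ^ k ≈ 0#)
    ^-≉0 zero    x≉0 = 1≉0
    ^-≉0 (suc k) x≉0 = *-≉0 x≉0 (^-≉0 k x≉0)

    inverse-≉0 : ∀ {x y} → x * y ≈ 1# → ¬ (y ≈ 0#)
    inverse-≉0 {x} xy≈1 y≈0 = 1≉0 (trans (sym xy≈1) (trans (*-congˡ y≈0) (zeroʳ x)))

    -- Multiplication by x permutes K; since f replaces 0 by 1, comparing the products of f over K
    -- and over xK leaves one factor x for each element of K except 0, which g accounts for.
    x^n≈x : ∀ {x} → ¬ (x ≈ 0#) → x ^ n ≈ x
    x^n≈x {x} x≉0 = begin
      x ^ n            ≈⟨ *-cancelˡ-≉0 ∏f≉0 (trans (*-comm _ _) (trans count (*-comm _ _))) ⟩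
      Π.sum (g ∘ enum) ≈⟨ ∏g≈x ⟩
      x                ∎
      where
      f g : Carrier → Carrier
      f y with y ≈? 0#
      ... | yes _ = 1#
      ... | no  _ = y
      g y with y ≈? 0#
      ... | yes _ = x
      ... | no  _ = 1#

      f-≉0 : ∀ y → ¬ (f y ≈ 0#)
      f-≉0 y with y ≈? 0#
      ... | yes _   = 1≉0
      ... | no  y≉0 = y≉0

      f-cong : ∀ {y z} → y ≈ z → f y ≈ f z
      f-cong {y} {z} y≈z with y ≈? 0# | z ≈? 0#
      ... | yes _   | yes _   = refl
      ... | yes y≈0 | no  z≉0 = contradiction (trans (sym y≈z) y≈0) z≉0
      ... | no  y≉0 | yes z≈0 = contradiction (trans y≈z z≈0) y≉0
      ... | no  _   | no  _   = y≈z

      x*f≈g*f : ∀ y → x * f y ≈ g y * f (x * y)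
      x*f≈g*f y with y ≈? 0# | x * y ≈? 0#
      ... | yes _   | yes _    = refl
      ... | yes y≈0 | no  xy≉0 = contradiction (trans (*-congˡ y≈0) (zeroʳ x)) xy≉0
      ... | no  y≉0 | yes xy≈0 = contradiction xy≈0 (*-≉0 x≉0 y≉0)
      ... | no  _   | no  _    = sym (*-identityˡ _)

      w    = proj₁ (inverse x x≉0)
      xw≈1 = proj₂ (inverse x x≉0)

      σ : Permutation′ n
      σ = permutation (λ i → code (x * enum i)) (λ i → code (w * enum i))
            (λ i → inv x w i xw≈1) (λ i → inv w x i (trans (*-comm w x) xw≈1))
        where
        inv : ∀ u v i → u * v ≈ 1# → code (u * enum (code (v * enum i))) ≡ i
        inv u v i uv≈1 = ≡.trans (code-cong (begin
          u * enum (code (v * enum i)) ≈⟨ *-congˡ (enum-code _) ⟩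
          u * (v * enum i)             ≈⟨ *-assoc u v _ ⟨
          u * v * enum i               ≈⟨ *-congʳ uv≈1 ⟩
          1# * enum i                  ≈⟨ *-identityˡ _ ⟩
          enum i                       ∎)) (code-enum i)

      ∏f : Carrier
      ∏f = Π.sum (f ∘ enum)

      ∏-≉0 : ∀ {m} (h : Fin m → Carrier) → (∀ i → ¬ (h i ≈ 0#)) → ¬ (Π.sum h ≈ 0#)
      ∏-≉0 {zero}  h h≉0 = 1≉0
      ∏-≉0 {suc m} h h≉0 = *-≉0 (h≉0 zero) (∏-≉0 (h ∘ suc) (h≉0 ∘ suc))

      ∏f≉0 : ¬ (∏f ≈ 0#)
      ∏f≉0 = ∏-≉0 (f ∘ enum) (λ i → f-≉0 (enum i))

      count : x ^ n * ∏f ≈ Π.sum (g ∘ enum) * ∏f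
      count = begin
        x ^ n * ∏f                                             ≈⟨ *-congʳ (Π.sum-replicate n) ⟨
        Π.sum {n} (λ _ → x) * ∏f                               ≈⟨ Π.∑-distrib-+ (λ _ → x) (f ∘ enum) ⟨
        Π.sum (λ i → x * f (enum i))                           ≈⟨ Π.sum-cong-≋ (λ i → x*f≈g*f (enum i)) ⟩
        Π.sum (λ i → g (enum i) * f (x * enum i))              ≈⟨ Π.∑-distrib-+ (g ∘ enum) _ ⟩
        Π.sum (g ∘ enum) * Π.sum (λ i → f (x * enum i))
          ≈⟨ *-congˡ (Π.sum-cong-≋ (λ i → f-cong (enum-code (x * enum i)))) ⟨
        Π.sum (g ∘ enum) * Π.sum (λ i → f (enum (σ ⟨$⟩ʳ i)))   ≈⟨ *-congˡ (Π.sum-permute (f ∘ enum) σ) ⟨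
        Π.sum (g ∘ enum) * ∏f                                  ∎

      g-≈0 : ∀ {y} → y ≈ 0# → g y ≈ x
      g-≈0 {y} y≈0 with y ≈? 0#
      ... | yes _   = refl
      ... | no  y≉0 = contradiction y≈0 y≉0

      g-≉0 : ∀ {y} → ¬ (y ≈ 0#) → g y ≈ 1#
      g-≉0 {y} y≉0 with y ≈? 0#
      ... | yes y≈0 = contradiction y≈0 y≉0
      ... | no  _   = refl

      ∏g≈x : Π.sum (g ∘ enum) ≈ x
      ∏g≈x = trans
        (sum-supported-at *-commutativeMonoid (g ∘ enum) (code 0#)
          (λ j j≢0 → g-≉0 (λ eⱼ≈0 → j≢0 (enum-inj _ _ (trans eⱼ≈0 (sym (enum-code 0#)))))))
        (g-≈0 (enum-code 0#))

    -- [c₀, …, c_{d-1}] stands for the monic polynomial c₀ + c₁ x + … + c_{d-1} x^{d-1} + x^d.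
    evalMonic : List Carrier → Carrier → Carrier
    evalMonic []       x = 1#
    evalMonic (c ∷ cs) x = c + x * evalMonic cs x

    -- Synthetic division by X - r: each coefficient of the quotient is the value at `r` of a tail
    -- of the polynomial. The leading 1 stays implicit.
    quotient : List Carrier → Carrier → List Carrier
    quotient []            r = []
    quotient (c ∷ [])      r = []
    quotient (c ∷ c′ ∷ cs) r = evalMonic (c′ ∷ cs) r ∷ quotient (c′ ∷ cs) r

    length-quotient : ∀ c cs r → length (quotient (c ∷ cs) r) ≡ length cs
    length-quotient c []        r = ≡.refl
    length-quotient c (c′ ∷ cs) r = ≡.cong suc (length-quotient c′ cs r)

    [x-y]+y≈x : ∀ x y → (x - y) + y ≈ x
    [x-y]+y≈x x y = begin
      (x - y) + y   ≈⟨ +-assoc x (- y) y ⟩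
      x + (- y + y) ≈⟨ +-congˡ (-‿inverseˡ y) ⟩
      x + 0#        ≈⟨ +-identityʳ x ⟩
      x             ∎

    x*z≈[x-r]*z+r*z : ∀ x r z → x * z ≈ (x - r) * z + r * z
    x*z≈[x-r]*z+r*z x r z = begin
      x * z             ≈⟨ *-congʳ ([x-y]+y≈x x r) ⟨
      ((x - r) + r) * z ≈⟨ distribʳ z (x - r) r ⟩
      (x - r) * z + r * z ∎

    -- Division with remainder P(r). In the inductive step the tail is divided first, and splitting
    -- `x * v` into `(x - r) * v + r * v` supplies both the new coefficient `v` and the new
    -- remainder.
    evalMonic-quotient : ∀ c cs r x →
      evalMonic (c ∷ cs) x ≈ (x - r) * evalMonic (quotient (c ∷ cs) r) x + evalMonic (c ∷ cs) r
    evalMonic-quotient c [] r x = begin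
      c + x * 1#                         ≈⟨ +-congˡ (x*z≈[x-r]*z+r*z x r 1#) ⟩
      c + ((x - r) * 1# + r * 1#)        ≈⟨ S.x∙yz≈y∙xz c _ _ ⟩
      (x - r) * 1# + (c + r * 1#)        ∎
      where module S = Algebra.Properties.CommutativeSemigroup +-commutativeSemigroup
    evalMonic-quotient c (c′ ∷ cs) r x = begin
      c + x * u                                  ≈⟨ +-congˡ (*-congˡ (evalMonic-quotient c′ cs r x)) ⟩
      c + x * ((x - r) * q + v)                  ≈⟨ +-congˡ (distribˡ x _ v) ⟩
      c + (x * ((x - r) * q) + x * v)            ≈⟨ +-congˡ (+-cong (x∙yz≈y∙xz x _ q) (x*z≈[x-r]*z+r*z x r v)) ⟩
      c + ((x - r) * (x * q) + ((x - r) * v + r * v)) ≈⟨ +-congˡ (S.x∙yz≈yx∙z _ _ _) ⟩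
      c + (((x - r) * v + (x - r) * (x * q)) + r * v) ≈⟨ +-congˡ (+-congʳ (distribˡ (x - r) v (x * q))) ⟨
      c + ((x - r) * (v + x * q) + r * v)        ≈⟨ S.x∙yz≈y∙xz c _ _ ⟩
      (x - r) * (v + x * q) + (c + r * v)        ∎
      where
      module S = Algebra.Properties.CommutativeSemigroup +-commutativeSemigroup
      u = evalMonic (c′ ∷ cs) x
      v = evalMonic (c′ ∷ cs) r
      q = evalMonic (quotient (c′ ∷ cs) r) x

    -- Each root uses up one degree: any other root `x` makes `x - r` invertible, so it is a root of
    -- the quotient by X - r. In degree 0 the monic polynomial is 1, which has no root.
    length-roots≤degree : ∀ {rs} cs → AllPairs (λ x y → ¬ (x ≈ y)) rs →
      All (λ r → evalMonic cs r ≈ 0#) rs → length rs ≤ length cs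
    length-roots≤degree cs []          []              = z≤n
    length-roots≤degree [] (r≉ ∷ rs!)  (1≈0 ∷ _)       = contradiction 1≈0 1≉0
    length-roots≤degree {r ∷ rs} (c ∷ cs) (r≉ ∷ rs!) (root ∷ roots) =
      s≤s (≡.subst (length rs ≤_) (length-quotient c cs r)
            (length-roots≤degree (quotient (c ∷ cs) r) rs! (All.zipWith quotient-root (r≉ , roots))))
      where
      quotient-root : ∀ {x} → ¬ (r ≈ x) × evalMonic (c ∷ cs) x ≈ 0# → evalMonic (quotient (c ∷ cs) r) x ≈ 0#
      quotient-root {x} (r≉x , root′) = *-cancelˡ-≉0 x-r≉0 (begin
        (x - r) * q                            ≈⟨ +-identityʳ _ ⟨
        (x - r) * q + 0#                       ≈⟨ +-congˡ root ⟨
        (x - r) * q + evalMonic (c ∷ cs) r     ≈⟨ evalMonic-quotient c cs r x ⟨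
        evalMonic (c ∷ cs) x                   ≈⟨ root′ ⟩
        0#                                     ≈⟨ zeroʳ (x - r) ⟨
        (x - r) * 0#                           ∎)
        where
        q = evalMonic (quotient (c ∷ cs) r) x
        x-r≉0 : ¬ (x - r ≈ 0#)
        x-r≉0 x-r≈0 = r≉x (sym (x-y≈0⇒x≈y x-r≈0))
          where
          x-y≈0⇒x≈y : ∀ {x y} → x - y ≈ 0# → x ≈ y
          x-y≈0⇒x≈y {x} {y} eq = trans (sym ([x-y]+y≈x x y)) (trans (+-congʳ eq) (+-identityˡ y))

    evalMonic-replicate : ∀ k x → evalMonic (replicate k 0#) x ≈ x ^ k
    evalMonic-replicate zero    x = refl
    evalMonic-replicate (suc k) x = trans (+-identityˡ _) (*-congˡ (evalMonic-replicate k x))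

    module _ (q : ℕ) (1<q : 1 < q) where

      Fixed : Carrier → Set
      Fixed x = x ^ q ≈ x

      fixedCodes : List (Fin n)
      fixedCodes = filter (λ i → enum i ^ q ≈? enum i) (allFin n)

      length-fixedCodes : length fixedCodes ≤ q
      length-fixedCodes = ≡.subst₂ _≤_ (length-map enum fixedCodes) (length-X^q-X 1<q)
        (length-roots≤degree (X^q-X q) distinct (All.map⁺ (All.map (root 1<q) fixed)))
        where
        -- For q ≥ 2 the coefficients are 0, -1, 0, ..., 0 below the implicit leading 1. For q ≤ 1
        -- the polynomial is not monic of degree q; the default clause lies outside the range
        -- `1 < q`.
        X^q-X : ℕ → List Carrier
        X^q-X (suc (suc q)) = 0# ∷ - 1# ∷ replicate q 0#
        X^q-X _             = []

        length-X^q-X : ∀ {q} → 1 < q → length (X^q-X q) ≡ q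
        length-X^q-X {suc (suc q)} _ = ≡.cong (2 ℕ.+_) (length-replicate q)
        length-X^q-X {suc zero}    (s≤s ())

        root : ∀ {q i} → 1 < q → enum i ^ q ≈ enum i → evalMonic (X^q-X q) (enum i) ≈ 0#
        root {suc zero}        (s≤s ())
        root {suc (suc q)} {i} _ x^q≈x = begin
          0# + x * (- 1# + x * evalMonic (replicate q 0#) x) ≈⟨ +-identityˡ _ ⟩
          x * (- 1# + x * evalMonic (replicate q 0#) x)      ≈⟨ *-congˡ (+-congˡ (*-congˡ (evalMonic-replicate q x))) ⟩
          x * (- 1# + x * x ^ q)                             ≈⟨ distribˡ x (- 1#) _ ⟩
          x * - 1# + x * (x * x ^ q)                         ≈⟨ +-cong (trans (*-comm x _) (-1*x≈-x x)) x^q≈x ⟩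
          - x + x                                            ≈⟨ -‿inverseˡ x ⟩
          0#                                                 ∎
          where x = enum i

        fixed : All (Fixed ∘ enum) fixedCodes
        fixed = All.all-filter _ (allFin n)

        distinct : AllPairs (λ x y → ¬ (x ≈ y)) (map enum fixedCodes)
        distinct = AllPairs.map⁺ (AllPairs.map (λ i≢j eᵢ≈eⱼ → i≢j (enum-inj _ _ eᵢ≈eⱼ))
                     (Unique.filter⁺ _ (Unique.allFin⁺ n)))

      private
        code∈fixedCodes : ∀ {x} → Fixed x → code x ∈ fixedCodes
        code∈fixedCodes {x} fixed = ∈-filter⁺ _ (∈-allFin (code x))
          (trans (^-congˡ q (enum-code x)) (trans fixed (sym (enum-code x))))

      -- The position among the at most `q` fixed elements; it lets each ratio be recorded in
      -- `Fin q` when classes are counted.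
      fixedCode : ∀ x → Fixed x → Fin q
      fixedCode x fixed = inject≤ (index (code∈fixedCodes fixed)) length-fixedCodes

      fixedCode-injective : ∀ {x y} (fx : Fixed x) (fy : Fixed y) → fixedCode x fx ≡ fixedCode y fy → x ≈ y
      fixedCode-injective fx fy eq = code-injective (index-injective (≡.setoid (Fin n)) _ _
        (Fin.inject≤-injective length-fixedCodes length-fixedCodes _ _ eq))

  -- The exponent of the norm.

  normExp-suc : ∀ q k → normExp q (suc k) ≡ normExp q k ℕ.+ q ℕ.^ k
  normExp-suc q k = begin
    ℕ.sum (map (q ℕ.^_) (upTo (suc k)))              ≡⟨ ≡.cong (ℕ.sum ∘ map (q ℕ.^_)) (upTo-∷ʳ k) ⟨
    ℕ.sum (map (q ℕ.^_) (upTo k ∷ʳ k))               ≡⟨ ≡.cong ℕ.sum (map-++ (q ℕ.^_) (upTo k) [ k ]) ⟩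
    ℕ.sum (map (q ℕ.^_) (upTo k) ++ [ q ℕ.^ k ])     ≡⟨ sum-++ (map (q ℕ.^_) (upTo k)) [ q ℕ.^ k ] ⟩
    normExp q k ℕ.+ (q ℕ.^ k ℕ.+ 0)                ≡⟨ ≡.cong (normExp q k ℕ.+_) (ℕ.+-identityʳ _) ⟩
    normExp q k ℕ.+ q ℕ.^ k                        ∎
    where open ≡.≡-Reasoning

  -- The geometric sum (q - 1) e = q^k - 1, written without subtraction.
  suc[q*normExp] : ∀ q k → suc (q ℕ.* normExp q k) ≡ normExp q k ℕ.+ q ℕ.^ k
  suc[q*normExp] q zero = ≡.cong suc (ℕ.*-zeroʳ q)
  suc[q*normExp] q (suc k) = begin
    suc (q ℕ.* normExp q (suc k))           ≡⟨ ≡.cong (λ e → suc (q ℕ.* e)) (normExp-suc q k) ⟩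
    suc (q ℕ.* (e ℕ.+ q ℕ.^ k))             ≡⟨ ≡.cong suc (ℕ.*-distribˡ-+ q e (q ℕ.^ k)) ⟩
    suc (q ℕ.* e) ℕ.+ q ℕ.* q ℕ.^ k         ≡⟨ ≡.cong (ℕ._+ q ℕ.* q ℕ.^ k) (suc[q*normExp] q k) ⟩
    e ℕ.+ q ℕ.^ k ℕ.+ q ℕ.* q ℕ.^ k         ≡⟨ ≡.cong (ℕ._+ q ℕ.* q ℕ.^ k) (normExp-suc q k) ⟨
    normExp q (suc k) ℕ.+ q ℕ.* q ℕ.^ k     ∎
    where
    open ≡.≡-Reasoning
    e = normExp q k

  join-injective : ∀ m n {x y : Fin m ⊎ Fin n} → join m n x ≡ join m n y → x ≡ y
  join-injective m n {x} {y} eq =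
    ≡.trans (≡.sym (Fin.splitAt-join m n x)) (≡.trans (≡.cong (splitAt m) eq) (Fin.splitAt-join m n y))

  -- The projective norm graph for t = k + 2, with t-1 points `α i` and t-2 ratios.

  module _ (q k : ℕ) (1<q : 1 < q) (K : FiniteField (q ℕ.^ suc k)) where
    open FiniteField K hiding (zero)
    open ProjNormGraph q (suc (suc k)) K
    open Algebra.Properties.Ring ring
    open Algebra.Properties.Semiring.Exp semiring
    open Algebra.Properties.CommutativeSemiring.Exp commutativeSemiring using (^-distrib-*)
    open Algebra.Properties.CommutativeSemigroup *-commutativeSemigroup
    open Relation.Binary.Reasoning.Setoid setoid

    private N = q ℕ.^ suc k

    inFqStar : ∀ {x} → ¬ (x ≈ 0#) → x ^ q ≈ x → InFqStar x
    inFqStar {x} x≉0 fixed = x≉0 , trans (reflexive (pow≡^ K x q)) fixed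

    -- With `e` the norm exponent, 1 + q e = e + N and x^N = x give x (x^e)^q = x^e x; then `x`
    -- cancels.
    norm-inFqStar : ∀ {x} → ¬ (x ≈ 0#) → InFqStar (norm x)
    norm-inFqStar {x} x≉0 rewrite pow≡^ K x (normExp q (suc k)) =
      inFqStar (^-≉0 K e x≉0) (*-cancelˡ-≉0 K x≉0 (begin
        x * (x ^ e) ^ q    ≈⟨ *-congˡ (^-assocʳ x e q) ⟩
        x ^ suc (e ℕ.* q)  ≡⟨ ≡.cong (λ z → x ^ suc z) (ℕ.*-comm e q) ⟩
        x ^ suc (q ℕ.* e)  ≡⟨ ≡.cong (x ^_) (suc[q*normExp] q (suc k)) ⟩
        x ^ (e ℕ.+ N)      ≈⟨ ^-homo-* x e N ⟩
        x ^ e * x ^ N      ≈⟨ *-congˡ (x^n≈x K x≉0) ⟩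
        x ^ e * x          ≈⟨ *-comm (x ^ e) x ⟩
        x * x ^ e          ∎))
      where e = normExp q (suc k)

    InFqStar⇒fixed : ∀ {x} → InFqStar x → x ^ q ≈ x
    InFqStar⇒fixed {x} (_ , fixed) = trans (sym (reflexive (pow≡^ K x q))) fixed

    *-inFqStar : ∀ {x y} → InFqStar x → InFqStar y → InFqStar (x * y)
    *-inFqStar {x} {y} x∈ y∈ = inFqStar (*-≉0 K (proj₁ x∈) (proj₁ y∈))
      (trans (^-distrib-* x y q) (*-cong (InFqStar⇒fixed x∈) (InFqStar⇒fixed y∈)))

    inverse-inFqStar : ∀ {x y} → InFqStar x → x * y ≈ 1# → InFqStar y
    inverse-inFqStar {x} {y} x∈ xy≈1 = inFqStar (inverse-≉0 K xy≈1) (*-cancelˡ-≉0 K (proj₁ x∈) (begin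
      x * y ^ q      ≈⟨ *-congʳ (InFqStar⇒fixed x∈) ⟨
      x ^ q * y ^ q  ≈⟨ ^-distrib-* x y q ⟨
      (x * y) ^ q    ≈⟨ ^-congˡ q xy≈1 ⟩
      1# ^ q         ≈⟨ 1^ q ⟩
      1#             ≈⟨ xy≈1 ⟨
      x * y          ∎))
      where
      1^ : ∀ m → 1# ^ m ≈ 1#
      1^ zero    = refl
      1^ (suc m) = trans (*-identityˡ _) (1^ m)

    module _ (α : Fin (suc k) → Carrier) where

      -- The first alternative would let the two sides of the bipartite graph meet; the second makes
      -- a norm vanish, so that it is no label in F_q*.
      Bad : Carrier → Fin (suc k) → Set
      Bad x i = x ≈ α i ⊎ α i + x ≈ 0#

      Good : Carrier → Set
      Good x = ¬ ∃ (Bad x)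

      bad? : ∀ x → Dec (∃ (Bad x))
      bad? x = Fin.any? λ i → _≈?_ K x (α i) ⊎-dec _≈?_ K (α i + x) 0#

      norm∈ : ∀ {x} → Good x → ∀ i → InFqStar (norm (α i + x))
      norm∈ good i = norm-inFqStar λ eq → good (i , inj₂ eq)

      module _ {x} (good : Good x) where
        private
          inv = inverse (norm (α zero + x)) (proj₁ (norm∈ good zero))

        quot : Fin (suc k) → Carrier
        quot i = norm (α i + x) * proj₁ inv

        quot∈ : ∀ i → InFqStar (quot i)
        quot∈ i = *-inFqStar (norm∈ good i) (inverse-inFqStar (norm∈ good zero) (proj₂ inv))

        quot-* : ∀ i → quot i * norm (α zero + x) ≈ norm (α i + x)
        quot-* i = begin
          norm (α i + x) * proj₁ inv * norm (α zero + x)   ≈⟨ xy∙z≈x∙zy _ _ _ ⟩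
          norm (α i + x) * (norm (α zero + x) * proj₁ inv) ≈⟨ *-congˡ (proj₂ inv) ⟩
          norm (α i + x) * 1#                              ≈⟨ *-identityʳ _ ⟩
          norm (α i + x)                                   ∎

        quot-zero : quot zero ≈ 1#
        quot-zero = proj₂ inv

      -- An excluded element shares its class with no other, so a class with two elements is one of good ones.
      Class : Set
      Class = Fin (q ℕ.^ k) ⊎ (Fin (suc k) ⊎ Fin (suc k))

      class : ∀ {x} → Dec (∃ (Bad x)) → Class
      class (yes (i , inj₁ _)) = inj₂ (inj₁ i)
      class (yes (i , inj₂ _)) = inj₂ (inj₂ i)
      -- Only indices `suc i` are recorded, since the ratio at `zero` is always 1. This is the
      -- factor `q` saved: `q ^ k` classes in a field of order `q ^ suc k`.
      class (no good)          = inj₁ (funToFin λ i →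
        fixedCode K q 1<q (quot good (suc i)) (InFqStar⇒fixed (quot∈ good (suc i))))

      -- `quot` depends on a proof of goodness through the chosen inverse. The cross-multiplied form
      -- does not mention these proofs, so one proof for `x` can later serve against every `y`.
      quot-≈⇒cross : ∀ {x y} (gx : Good x) (gy : Good y) i → quot gx i ≈ quot gy i →
        norm (α i + x) * norm (α zero + y) ≈ norm (α i + y) * norm (α zero + x)
      quot-≈⇒cross {x} {y} gx gy i eq = begin
        norm (α i + x) * Ny      ≈⟨ *-congʳ (quot-* gx i) ⟨
        quot gx i * Nx * Ny      ≈⟨ xy∙z≈xz∙y _ _ _ ⟩
        quot gx i * Ny * Nx      ≈⟨ *-congʳ (*-congʳ eq) ⟩
        quot gy i * Ny * Nx      ≈⟨ *-congʳ (quot-* gy i) ⟩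
        norm (α i + y) * Nx      ∎
        where
        Nx = norm (α zero + x)
        Ny = norm (α zero + y)

      -- Elements excluded for the same reason at the same index coincide, being both `α i` or both
      -- its negative. For good elements the recorded ratios are read back through `finToFun`.
      class-≡ : ∀ {x y} (x? : Dec (∃ (Bad x))) (y? : Dec (∃ (Bad y))) → class x? ≡ class y? →
        x ≈ y ⊎ Good x × Good y ×
          (∀ i → norm (α i + x) * norm (α zero + y) ≈ norm (α i + y) * norm (α zero + x))
      class-≡ (yes (i , inj₁ x≈α)) (yes (.i , inj₁ y≈α)) ≡.refl = inj₁ (trans x≈α (sym y≈α))
      class-≡ (yes (i , inj₂ αx≈0)) (yes (.i , inj₂ αy≈0)) ≡.refl =
        inj₁ (+-cancelˡ (α i) _ _ (trans αx≈0 (sym αy≈0)))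
      class-≡ (yes (_ , inj₁ _)) (yes (_ , inj₂ _)) ()
      class-≡ (yes (_ , inj₂ _)) (yes (_ , inj₁ _)) ()
      class-≡ (yes (_ , inj₁ _)) (no _) ()
      class-≡ (yes (_ , inj₂ _)) (no _) ()
      class-≡ (no _) (yes (_ , inj₁ _)) ()
      class-≡ (no _) (yes (_ , inj₂ _)) ()
      class-≡ (no gx) (no gy) eq = inj₂ (gx , gy , λ i → quot-≈⇒cross gx gy i (quot-≈ i))
        where
        quot-≈ : ∀ i → quot gx i ≈ quot gy i
        quot-≈ zero    = trans (quot-zero gx) (sym (quot-zero gy))
        quot-≈ (suc i) = fixedCode-injective K q 1<q _ _
          (≡.trans (≡.sym (Fin.finToFun-funToFin _ i))
            (≡.trans (≡.cong (λ c → finToFun c i) (inj₁-injective eq)) (Fin.finToFun-funToFin _ i)))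

      classCode : Carrier → Fin (q ℕ.^ k ℕ.+ (suc k ℕ.+ suc k))
      classCode x = join _ _ (map₂ (join _ _) (class (bad? x)))

      classCode-≡ : ∀ {x y} → classCode x ≡ classCode y → class (bad? x) ≡ class (bad? y)
      classCode-≡ eq = map₂-join-injective (join-injective _ _ eq)
        where
        map₂-join-injective : ∀ {c d : Class} → map₂ (join _ _) c ≡ map₂ (join _ _) d → c ≡ d
        map₂-join-injective {inj₁ _} {inj₁ _} ≡.refl = ≡.refl
        map₂-join-injective {inj₂ _} {inj₂ _} eq = ≡.cong inj₂ (join-injective _ _ (inj₂-injective eq))

      -- The fibre has one point more than the right side needs. The extra point `x₀` fixes the
      -- labels `quot good₀ i` of the left side, and its being distinct from each `y j` forces both
      -- to be good.
      containsKrs-fibre : ∀ {m} → (∀ i j → α i ≈ α j → i ≡ j) →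
        (g : Fin (suc (suc m)) → Fin N) → (∀ i j → g i ≡ g j → i ≡ j) →
        (∀ i j → classCode (enum (g i)) ≡ classCode (enum (g j))) →
        ContainsKrs (suc k) (suc m)
      containsKrs-fibre {m} α-injective g g-injective same
        = A , B
        , (λ i j Aᵢ≈Aⱼ → α-injective i j (proj₁ Aᵢ≈Aⱼ))
        , (λ i j Bᵢ≈Bⱼ → Fin.suc-injective (g-injective _ _ (enum-inj _ _ (proj₁ Bᵢ≈Bⱼ))))
        , A≉B , λ i j → A≉B i j , adjacent i j
        where
        x₀ : Carrier
        x₀ = enum (g zero)

        y : Fin (suc m) → Carrier
        y j = enum (g (suc j))

        related : ∀ j → Good x₀ × Good (y j) ×
          (∀ i → norm (α i + x₀) * norm (α zero + y j) ≈ norm (α i + y j) * norm (α zero + x₀))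
        related j with class-≡ (bad? x₀) (bad? (y j)) (classCode-≡ (same zero (suc j)))
        ... | inj₂ r    = r
        ... | inj₁ x₀≈y = contradiction (g-injective _ _ (enum-inj _ _ x₀≈y)) λ ()

        good₀ : Good x₀
        good₀ = proj₁ (related zero)

        good : ∀ j → Good (y j)
        good j = proj₁ (proj₂ (related j))

        A : Fin (suc k) → Vertex
        A i = α i , quot good₀ i , quot∈ good₀ i

        B : Fin (suc m) → Vertex
        B j = y j , norm (α zero + y j) , norm∈ (good j) zero

        A≉B : ∀ i j → ¬ (A i ≈V B j)
        A≉B i j (α≈y , _) = good j (i , inj₁ (sym α≈y))

        adjacent : ∀ i j → norm (α i + y j) ≈ quot good₀ i * norm (α zero + y j)
        -- After multiplication by `N₀`, the cross relation trades `y j` for `x₀` in the norm at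
        -- `α i`, where the ratio is known.
        adjacent i j = *-cancelˡ-≉0 K (proj₁ (norm∈ good₀ zero)) (begin
          N₀ * norm (α i + y j)         ≈⟨ *-comm _ _ ⟩
          norm (α i + y j) * N₀         ≈⟨ proj₂ (proj₂ (related j)) i ⟨
          norm (α i + x₀) * Nⱼ          ≈⟨ *-congʳ (quot-* good₀ i) ⟨
          quot good₀ i * N₀ * Nⱼ        ≈⟨ xy∙z≈y∙xz _ _ _ ⟩
          N₀ * (quot good₀ i * Nⱼ)      ∎)
          where
          N₀ = norm (α zero + x₀)
          Nⱼ = norm (α zero + y j)

      containsKrs : ∀ m → (∀ i j → α i ≈ α j → i ≡ j) →
        suc m ℕ.* (q ℕ.^ k ℕ.+ (suc k ℕ.+ suc k)) < N → ContainsKrs (suc k) (suc m)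
      containsKrs m α-injective bound =
        let g , g-injective , same = pigeonhole-fibre (suc m) (classCode ∘ enum) bound
        in containsKrs-fibre α-injective g g-injective same

-- The choice of the bound on p.

open PrimesAbove
open NormGraph
open import Data.Nat using (ℕ; zero; suc; _+_; _*_; _≤_; _<_; _∸_; _^_; _⊔_; s≤s; z≤n; NonZero; >-nonZero;
  nonTrivial⇒n>1)
open import Data.Nat.Properties
open import Data.Nat.Primality using (Prime; prime⇒nonTrivial)
open import Data.Bool using (Bool; true)
open import Data.Fin using (Fin; inject≤)
open import Data.Fin.Properties using (inject≤-injective)
open import Data.Product using (Σ; ∃; _×_; _,_; proj₂)
open import Function using (_∘_)
open import Relation.Binary.PropositionalEquality using (_≡_)

-- Since q^k ≥ 1, the left side is at most (m + m c) q^k, so a bound on `q` that depends only on `m`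
-- and `c` suffices.
fibre-bound : ∀ q k m c → m + m * c < q → m * (q ^ k + c) < q ^ suc k
fibre-bound q k m c B<q = begin-strict
  m * (q ^ k + c)                 ≡⟨ *-distribˡ-+ m (q ^ k) c ⟩
  m * q ^ k + m * c               ≤⟨ +-monoʳ-≤ (m * q ^ k) (m≤m*n (m * c) (q ^ k)) ⟩
  m * q ^ k + m * c * q ^ k       ≡⟨ *-distribʳ-+ (q ^ k) m (m * c) ⟨
  (m + m * c) * q ^ k             <⟨ *-monoˡ-< (q ^ k) B<q ⟩
  q * q ^ k                       ∎
  where
  open ≤-Reasoning
  instance
    q≢0 : NonZero q
    q≢0 = >-nonZero (≤-<-trans z≤n B<q)
    q^k≢0 : NonZero (q ^ k)
    q^k≢0 = m^n≢0 q k

containsKrs-large : ∀ q k m (K : FiniteField (q ^ suc k)) → 1 < q →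
  suc m + suc m * (suc k + suc k) < q → ProjNormGraph.ContainsKrs q (suc (suc k)) K (suc k) (suc m)
containsKrs-large q k m K 1<q B<q = containsKrs q k 1<q K α m α-injective bound
  where
  open FiniteField K using (Carrier; _≈_; enum; enum-inj)

  bound : suc m * (q ^ k + (suc k + suc k)) < q ^ suc k
  bound = fibre-bound q k (suc m) (suc k + suc k) B<q

  -- The same bound already guarantees room in K for t-1 distinct points.
  1+k≤N : suc k ≤ q ^ suc k
  1+k≤N = ≤-trans (m≤m+n (suc k) (suc k)) (≤-trans (m≤n+m _ (q ^ k)) (≤-trans (m≤m+n _ _) (<⇒≤ bound)))

  α : Fin (suc k) → Carrier
  α i = enum (inject≤ i 1+k≤N)

  α-injective : ∀ i j → α i ≈ α j → i ≡ j
  α-injective i j = inject≤-injective 1+k≤N 1+k≤N i j ∘ enum-inj _ _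

theorem3 : (t m : ℕ) → 4 ≤ t → 1 ≤ m →
    Σ (ℕ → Bool) λ S →
    (∀ p → S p ≡ true → Prime p)
    × (∀ n → ∃ λ p → n < p × S p ≡ true)
    × HasPositiveDensity S
    × (∀ p → S p ≡ true → (K : FiniteField (p ^ (t ∸ 1))) →
    ProjNormGraph.ContainsKrs p t K (t ∸ 1) m)
theorem3 (suc (suc k)) (suc m) 4≤t 1≤m =
    primesAbove B
  , (λ p p∈S → proj₂ (primesAbove-sound B p∈S))
  , infinite
  , primesAbove-density B
  , λ p p∈S K → let B<p , pr = primesAbove-sound B p∈S in
      containsKrs-large p k m K (nonTrivial⇒n>1 p ⦃ prime⇒nonTrivial pr ⦄) B<p
  where
  -- This is m + m c for the m of the theorem, here `suc m`, with c = 2(t-1): two exclusions for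
  -- each of the t-1 points `α i`.
  B = suc m + suc m * (suc k + suc k)

  infinite : ∀ n → ∃ λ p → n < p × primesAbove B p ≡ true
  infinite n with p , n⊔B<p , pr ← ∃prime> (n ⊔ B) =
    p , ≤-<-trans (m≤m⊔n n B) n⊔B<p , primesAbove-complete B (≤-<-trans (m≤n⊔m n B) n⊔B<p) pr
theorem3 (suc zero) _ (s≤s ())
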